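{- For every integer $n\ge 0$, the number $N_{CSSG}(G_n)$ of connected spanning subgraphs of the Farey graph $G_n$ is $$N_{CSSG}(G_n)=2^{2^n-1}(n+1)\prod_{i=2}^{n} i^{2^{n-i}},$$ where an empty product equals $1$.
   Context: The Farey graphs $G_n$ ($n\ge 0$), each with two distinguished ("special") vertices $X_n,Y_n$, are defined recursively. $G_0$ is a single edge joining its two special vertices $X_0$ and $Y_0$. For $n\ge 1$, take two disjoint copies $G_{n-1}^1,G_{n-1}^2$ of $G_{n-1}$, with special vertices $X_{n-1}^i,Y_{n-1}^i$ ($i=1,2$); identify $Y_{n-1}^1$ with $X_{n-1}^2$ into one vertex, and add a new edge $e_n$ joining $X_{n-1}^1$ and $Y_{n-1}^2$. The result is $G_n$, with special vertices $X_n=X_{n-1}^1$ and $Y_n=Y_{n-1}^2$. It has $2^n+1$ vertices and $2^{n+1}-1$ edges. A connected spanning subgraph of a graph $G$ is a connected subgraph $H$ with $V(H)=V(G)$ and $E(H)\subseteq E(G)$; subgraphs are counted as distinct when their edge sets differ. -}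

module Defs where

open import Data.Nat.Base using (ℕ; zero; suc; _+_; _∸_)
import Data.Nat.Base as ℕ
import Data.Nat.Properties as ℕₚ
open import Data.Bool.Base using (true; false)
open import Data.Fin.Base using (Fin; zero; suc; toℕ; fromℕ; _↑ˡ_; _<_)
open import Data.Fin.Properties
  using (_≟_; all?; toℕ-↑ˡ; toℕ-fromℕ; ↑ˡ-injective; toℕ-injective; toℕ≤pred[n])
open import Data.Fin.Subset using (Subset; inside; outside; _∈_)
open import Data.List.Base as List using (List; length; filter; applyUpTo)
open import Data.Nat.ListAction using (product)
open import Data.Vec.Base using (Vec; []; _∷_; _++_; map; lookup; here; there)
open import Data.Vec.Relation.Unary.All as All using (All; []; _∷_)
import Data.Vec.Relation.Unary.All.Properties as Allₚ
open import Data.Vec.Relation.Unary.AllPairs using ([]; _∷_)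
import Data.Vec.Relation.Unary.AllPairs.Properties as AllPairsₚ
open import Data.Vec.Relation.Unary.Unique.Propositional using (Unique)
import Data.Vec.Relation.Unary.Unique.Propositional.Properties as Uniqueₚ
open import Data.Product.Base as Product using (_×_; _,_; proj₁; proj₂; ∃)
open import Data.Product.Properties using (,-injective)
open import Data.Sum.Base using (_⊎_; inj₁; inj₂; [_,_]′)
open import Function.Base using (_∘_)
open import Relation.Binary.Core using (Rel; _⇒_)
open import Relation.Binary.PropositionalEquality
  using (_≡_; _≢_; refl; sym; trans; cong; cong₂; subst; subst₂)
open import Relation.Binary.Construct.Closure.ReflexiveTransitive using (ε; _◅_; _◅◅_)
open import Relation.Binary.Construct.Closure.Symmetric using (SymClosure; fwd; bwd)
open import Relation.Binary.Construct.Closure.Equivalence as Eq using (EqClosure)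
open import Relation.Nullary.Decidable using (Dec; yes; no; map′; _×-dec_; _⊎-dec_)
open import Relation.Unary using (Decidable)

-- A finite simple graph on Fin v.  Each undirected edge is listed exactly once,
-- smaller endpoint first, so that Subset size is the type of sets of edges.

record Graph (v : ℕ) : Set where
  field
    size     : ℕ
    edges    : Vec (Fin v × Fin v) size
    ordered  : All (λ (a , b) → a < b) edges
    distinct : Unique edges

-- Spanning subgraphs of G are sets S of edges; two vertices lie in the same
-- component when a walk (a reflexive-transitive chain of edges of S, each
-- traversed in either direction) joins them.

Joins : ∀ {v m} → Vec (Fin v × Fin v) m → Subset m → Rel (Fin v) _
Joins es S a b = ∃ λ e → e ∈ S × lookup es e ≡ (a , b)

Walk : ∀ {v m} → Vec (Fin v × Fin v) m → Subset m → Rel (Fin v) _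
Walk es S = EqClosure (Joins es S)

ConnectedSpanning : ∀ {v} (G : Graph v) → Subset (Graph.size G) → Set
ConnectedSpanning G S = ∀ a b → Walk (Graph.edges G) S a b

private
  module _ {v m : ℕ} {es : Vec (Fin v × Fin v) m} {S : Subset m} {x y : Fin v} where

    weaken : ∀ {s} → Joins es S ⇒ Joins ((x , y) ∷ es) (s ∷ S)
    weaken (e , e∈S , eq) = suc e , there e∈S , eq

    skip : Joins ((x , y) ∷ es) (outside ∷ S) ⇒ Joins es S
    skip (suc e , there e∈S , eq) = e , e∈S , eq

    Through : Rel (Fin v) _
    Through a b = Walk es S a b ⊎ (Walk es S a x × Walk es S y b
                                ⊎ Walk es S a y × Walk es S x b)

    to : Walk ((x , y) ∷ es) (inside ∷ S) ⇒ Through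
    to ε = inj₁ ε
    to (fwd (zero , here , refl) ◅ w) with to w
    ... | inj₁ p               = inj₂ (inj₁ (ε , p))
    ... | inj₂ (inj₁ (_ , q))  = inj₂ (inj₁ (ε , q))
    ... | inj₂ (inj₂ (_ , q))  = inj₁ q
    to (bwd (zero , here , refl) ◅ w) with to w
    ... | inj₁ p               = inj₂ (inj₂ (ε , p))
    ... | inj₂ (inj₁ (_ , q))  = inj₁ q
    ... | inj₂ (inj₂ (_ , q))  = inj₂ (inj₂ (ε , q))
    to (fwd (suc e , there e∈S , eq) ◅ w) with to w
    ... | inj₁ p               = inj₁ (fwd (e , e∈S , eq) ◅ p)
    ... | inj₂ (inj₁ (p , q))  = inj₂ (inj₁ (fwd (e , e∈S , eq) ◅ p , q))
    ... | inj₂ (inj₂ (p , q))  = inj₂ (inj₂ (fwd (e , e∈S , eq) ◅ p , q))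
    to (bwd (suc e , there e∈S , eq) ◅ w) with to w
    ... | inj₁ p               = inj₁ (bwd (e , e∈S , eq) ◅ p)
    ... | inj₂ (inj₁ (p , q))  = inj₂ (inj₁ (bwd (e , e∈S , eq) ◅ p , q))
    ... | inj₂ (inj₂ (p , q))  = inj₂ (inj₂ (bwd (e , e∈S , eq) ◅ p , q))

    from : Through ⇒ Walk ((x , y) ∷ es) (inside ∷ S)
    from (inj₁ p) = Eq.map weaken p
    from (inj₂ (inj₁ (p , q))) =
      Eq.map weaken p ◅◅ (fwd (zero , here , refl) ◅ Eq.map weaken q)
    from (inj₂ (inj₂ (p , q))) =
      Eq.map weaken p ◅◅ (bwd (zero , here , refl) ◅ Eq.map weaken q)

  emptyWalk : ∀ {v} {a b : Fin v} → Walk [] [] a b → a ≡ b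
  emptyWalk ε                    = refl
  emptyWalk (fwd (() , _) ◅ _)
  emptyWalk (bwd (() , _) ◅ _)

walk? : ∀ {v m} (es : Vec (Fin v × Fin v) m) (S : Subset m) →
        ∀ a b → Dec (Walk es S a b)
walk? []             []            a b = map′ (λ { refl → ε }) emptyWalk (a ≟ b)
walk? (_ ∷ es)       (false ∷ S) a b =
  map′ (Eq.map weaken) (Eq.map skip) (walk? es S a b)
walk? ((x , y) ∷ es) (true ∷ S)  a b =
  map′ from to
    (walk? es S a b ⊎-dec (walk? es S a x ×-dec walk? es S y b
                           ⊎-dec walk? es S a y ×-dec walk? es S x b))

connectedSpanning? : ∀ {v} (G : Graph v) → Decidable (ConnectedSpanning G)
connectedSpanning? G S = all? λ a → all? λ b → walk? (Graph.edges G) S a b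

allSubsets : ∀ m → List (Subset m)
allSubsets zero    = List.[ [] ]
allSubsets (suc m) = List.map (outside ∷_) (allSubsets m)
               List.++ List.map (inside  ∷_) (allSubsets m)

N-CSSG : ∀ {v} → Graph v → ℕ
N-CSSG G = length (filter (connectedSpanning? G) (allSubsets (Graph.size G)))

-- In a graph on Fin (suc k) the special vertices are X = zero and Y = fromℕ k.
-- Gluing graphs on Fin (suc k) and Fin (suc l) at Y¹ = X² gives a graph on
-- Fin (suc (k + l)): vertex i of the first copy becomes i, vertex j of the
-- second becomes k + j.  The new edge XY is listed first.

fromLeft : ∀ k l → Fin (suc k) → Fin (suc (k + l))
fromLeft k l i = i ↑ˡ l

fromRight : ∀ k l → Fin (suc l) → Fin (suc (k + l))
fromRight zero    l j = j
fromRight (suc k) l j = suc (fromRight k l j)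

identified : ∀ k l → fromLeft k l (fromℕ k) ≡ fromRight k l zero
identified zero    l = refl
identified (suc k) l = cong suc (identified k l)

toℕ-fromRight : ∀ k l (j : Fin (suc l)) → toℕ (fromRight k l j) ≡ k + toℕ j
toℕ-fromRight zero    l j = refl
toℕ-fromRight (suc k) l j = cong suc (toℕ-fromRight k l j)

both : ∀ {A B : Set} → (A → B) → A × A → B × B
both f = Product.map f f

module _ {k l : ℕ} (0<k : 0 ℕ.< k) (0<l : 0 ℕ.< l)
         (G : Graph (suc k)) (H : Graph (suc l)) where

  private
    module G = Graph G
    module H = Graph H
    V = Fin (suc (k + l))

    onLeft : Fin (suc k) × Fin (suc k) → V × V
    onLeft = both (fromLeft k l)

    onRight : Fin (suc l) × Fin (suc l) → V × V
    onRight = both (fromRight k l)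

    left≤ : ∀ i → toℕ (fromLeft k l i) ℕ.≤ k
    left≤ i = subst (ℕ._≤ k) (sym (toℕ-↑ˡ i l)) (toℕ≤pred[n] i)

    right≥ : ∀ j → k ℕ.≤ toℕ (fromRight k l j)
    right≥ j = subst (k ℕ.≤_) (sym (toℕ-fromRight k l j)) (ℕₚ.m≤m+n k (toℕ j))

    left-mono : ∀ {a b : Fin (suc k)} → a < b → fromLeft k l a < fromLeft k l b
    left-mono {a} {b} = subst₂ ℕ._<_ (sym (toℕ-↑ˡ a l)) (sym (toℕ-↑ˡ b l))

    right-mono : ∀ {a b : Fin (suc l)} → a < b → fromRight k l a < fromRight k l b
    right-mono {a} {b} a<b =
      subst₂ ℕ._<_ (sym (toℕ-fromRight k l a)) (sym (toℕ-fromRight k l b)) (ℕₚ.+-monoʳ-< k a<b)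

    right-inj : ∀ {a b} → fromRight k l a ≡ fromRight k l b → a ≡ b
    right-inj {a} {b} eq = toℕ-injective (ℕₚ.+-cancelˡ-≡ k _ _
      (trans (sym (toℕ-fromRight k l a)) (trans (cong toℕ eq) (toℕ-fromRight k l b))))

    onLeft-inj : ∀ {p q} → onLeft p ≡ onLeft q → p ≡ q
    onLeft-inj eq with ,-injective eq
    ... | eq₁ , eq₂ = cong₂ _,_ (↑ˡ-injective l _ _ eq₁) (↑ˡ-injective l _ _ eq₂)

    onRight-inj : ∀ {p q} → onRight p ≡ onRight q → p ≡ q
    onRight-inj eq with ,-injective eq
    ... | eq₁ , eq₂ = cong₂ _,_ (right-inj eq₁) (right-inj eq₂)

    left≢right : ∀ {p : Fin (suc k) × Fin (suc k)} {q} → proj₁ p < proj₂ p → onLeft p ≢ onRight q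
    left≢right {a , b} {c , d} a<b eq = ℕₚ.<-irrefl refl (ℕₚ.<-≤-trans
      (left-mono a<b)
      (ℕₚ.≤-trans (left≤ b) (subst (λ z → k ℕ.≤ toℕ z) (sym (cong proj₁ eq)) (right≥ c))))

    XY : V × V
    XY = zero , fromℕ (k + l)

    XY≢left : ∀ p → XY ≢ onLeft p
    XY≢left (a , b) eq = ℕₚ.<⇒≱ (ℕₚ.m<m+n k 0<l)
      (subst (ℕ._≤ k) (trans (cong (toℕ ∘ proj₂) (sym eq)) (toℕ-fromℕ (k + l))) (left≤ b))

    XY≢right : ∀ q → XY ≢ onRight q
    XY≢right (c , d) eq = ℕₚ.<⇒≱ 0<k
      (subst (k ℕ.≤_) (cong (toℕ ∘ proj₁) (sym eq)) (right≥ c))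

  glue : Graph (suc (k + l))
  glue = record
    { size     = suc (G.size + H.size)
    ; edges    = (zero , fromℕ (k + l)) ∷ map (both (fromLeft k l)) G.edges
                                      ++ map (both (fromRight k l)) H.edges
    ; ordered  = subst (0 ℕ.<_) (sym (toℕ-fromℕ (k + l))) (ℕₚ.<-≤-trans 0<k (ℕₚ.m≤m+n k l))
               ∷ Allₚ.++⁺ (Allₚ.map⁺ (All.map left-mono G.ordered))
                          (Allₚ.map⁺ (All.map right-mono H.ordered))
    ; distinct = Allₚ.++⁺ (Allₚ.map⁺ (All.universal XY≢left G.edges))
                          (Allₚ.map⁺ (All.universal XY≢right H.edges))
               ∷ AllPairsₚ.++⁺ (Uniqueₚ.map⁺ onLeft-inj G.distinct)
                               (Uniqueₚ.map⁺ onRight-inj H.distinct)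
                   (Allₚ.map⁺ (All.map
                     (λ a<b → Allₚ.map⁺ (All.universal (λ _ → left≢right a<b) H.edges))
                     G.ordered))
    }

-- 2 ^ n, by a recursion that matches the type of glue definitionally.
span : ℕ → ℕ
span zero    = 1
span (suc n) = span n + span n

span>0 : ∀ n → 0 ℕ.< span n
span>0 zero    = ℕ.s≤s ℕ.z≤n
span>0 (suc n) = ℕₚ.<-≤-trans (span>0 n) (ℕₚ.m≤m+n (span n) (span n))

farey : ∀ n → Graph (suc (span n))
farey zero = record
  { size     = 1
  ; edges    = (zero , suc zero) ∷ []
  ; ordered  = ℕ.s≤s ℕ.z≤n ∷ []
  ; distinct = [] ∷ []
  }
farey (suc n) = glue (span>0 n) (span>0 n) (farey n) (farey n)

-- ∏[ a ⋯ b ] f = f a * f (a + 1) * ⋯ * f b, and 1 when b < a.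
∏[_⋯_] : ℕ → ℕ → (ℕ → ℕ) → ℕ
∏[ a ⋯ b ] f = product (applyUpTo (λ j → f (a + j)) (suc b ∸ a))

{-# OPTIONS --safe #-}

-- Call a set of edges split when the component of X and the component of Y are
-- distinct and cover all vertices.  Let t and s count the connected and the split
-- sets.  A wedge of two graphs is connected iff both parts are, and split iff
-- exactly one part is split and the other is connected; an extra edge XY connects
-- both kinds.  Hence t′ = t² + (t² + 2ts) and s′ = 2ts along the recursion, whose
-- solution is t = (n + 1) s with s₀ = 1 and s′ = 2 (n + 1) s².

module Submission where

open import Defs
open import Data.Nat using (ℕ; _+_; _*_; _∸_; _^_)
open import Relation.Binary.PropositionalEquality using (_≡_)

open import Data.Bool.Base using (true; false; if_then_else_)
open import Data.Fin.Base using (Fin; zero; suc; fromℕ)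
open import Data.Fin.Properties using (all?)
open import Data.Fin.Subset using (Subset; inside; outside)
open import Data.List.Base as List using (List; []; _∷_; length; filter; applyUpTo)
open import Data.List.Properties using (applyUpTo-∷ʳ; filter-++; length-++)
open import Data.Nat.Base using (zero; suc; _<_)
open import Data.Nat.ListAction using (product)
open import Data.Nat.ListAction.Properties using (product-++)
open import Data.Nat.Properties
  using (+-identityʳ; +-suc; *-identityʳ; *-distribˡ-+; *-distribʳ-+; +-∸-assoc; n∸n≡0;
         ^-distribˡ-+-*; m^n≢0; m≤n⇒m≤1+n; ≤-refl)
open import Data.Nat.Tactic.RingSolver using (solve-∀)
open import Data.Product.Base using (_×_; _,_; proj₁; proj₂; ∃₂)
open import Data.Product.Properties using (,-injective)
open import Data.Sum.Base as Sum using (_⊎_; inj₁; inj₂)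
open import Data.Vec.Base using (Vec; []; _∷_; _++_; map; here; there)
open import Data.Vec.Properties using (lookup-map)
open import Function.Base using (_∘_)
open import Function.Bundles using (_⇔_; mk⇔)
open import Level using (Level)
import Relation.Binary.Construct.Closure.Equivalence as Eq
open import Relation.Binary.Construct.Closure.ReflexiveTransitive using (ε; _◅_; _◅◅_)
open import Relation.Binary.Construct.Closure.Symmetric using (SymClosure; fwd; bwd)
open import Relation.Binary.PropositionalEquality
  using (refl; sym; trans; cong; cong₂; subst; module ≡-Reasoning)
open import Relation.Nullary.Decidable
  using (Dec; yes; no; does; map′; ¬?; _×-dec_; _⊎-dec_; does-⇔)
open import Relation.Nullary.Negation using (¬_; contradiction)
open import Relation.Unary using (Decidable)

open ≡-Reasoning

private
  variable
    a : Level
    A B : Set a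
    k l m n v : ℕ

-- Sums over subsets

-- Reads only the truth value `does A?`, so that any two decision procedures for equivalent
-- propositions have equal indicators.
indicator : Dec A → ℕ
indicator A? = if does A? then 1 else 0

indicator-⇔ : A ⇔ B → (A? : Dec A) (B? : Dec B) → indicator A? ≡ indicator B?
indicator-⇔ A⇔B A? B? = cong (λ b → if b then 1 else 0) (does-⇔ A⇔B A? B?)

indicator-× : (A? : Dec A) (B? : Dec B) →
              indicator (A? ×-dec B?) ≡ indicator A? * indicator B?
indicator-× (no _)  _  = refl
indicator-× (yes _) B? = sym (+-identityʳ (indicator B?))

indicator-⊎ : ¬ (A × B) → (A? : Dec A) (B? : Dec B) →
              indicator (A? ⊎-dec B?) ≡ indicator A? + indicator B?
indicator-⊎ disjoint (yes p) (yes q) = contradiction (p , q) disjoint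
indicator-⊎ disjoint (yes _) (no _)  = refl
indicator-⊎ disjoint (no _)  _       = refl

indicator-no : ¬ A → (A? : Dec A) → indicator A? ≡ 0
indicator-no ¬p (yes p) = contradiction p ¬p
indicator-no ¬p (no _)  = refl

-- Branches on the first edge in the same order as `allSubsets`; conditioning on that edge is
-- therefore a definitional unfolding.
sumSubsets : ∀ m → (Subset m → ℕ) → ℕ
sumSubsets zero    f = f []
sumSubsets (suc m) f = sumSubsets m (f ∘ (outside ∷_)) + sumSubsets m (f ∘ (inside ∷_))

sumSubsets-cong : ∀ m {f g : Subset m → ℕ} → (∀ S → f S ≡ g S) →
                  sumSubsets m f ≡ sumSubsets m g
sumSubsets-cong zero    f≗g = f≗g []
sumSubsets-cong (suc m) f≗g =
  cong₂ _+_ (sumSubsets-cong m (f≗g ∘ (outside ∷_))) (sumSubsets-cong m (f≗g ∘ (inside ∷_)))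

sumSubsets-+ : ∀ m (f g : Subset m → ℕ) →
               sumSubsets m (λ S → f S + g S) ≡ sumSubsets m f + sumSubsets m g
sumSubsets-+ zero    f g = refl
sumSubsets-+ (suc m) f g = trans
  (cong₂ _+_ (sumSubsets-+ m (f ∘ (outside ∷_)) (g ∘ (outside ∷_)))
             (sumSubsets-+ m (f ∘ (inside ∷_)) (g ∘ (inside ∷_))))
  (interchange (sumSubsets m (f ∘ (outside ∷_))) _ _ _)
  where
  interchange : ∀ a b c d → (a + b) + (c + d) ≡ (a + c) + (b + d)
  interchange = solve-∀

sumSubsets-0 : ∀ m → sumSubsets m (λ _ → 0) ≡ 0
sumSubsets-0 zero    = refl
sumSubsets-0 (suc m) = cong₂ _+_ (sumSubsets-0 m) (sumSubsets-0 m)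

sumSubsets-*ˡ : ∀ m c (f : Subset m → ℕ) →
                sumSubsets m (λ S → c * f S) ≡ c * sumSubsets m f
sumSubsets-*ˡ zero    c f = refl
sumSubsets-*ˡ (suc m) c f = trans
  (cong₂ _+_ (sumSubsets-*ˡ m c (f ∘ (outside ∷_))) (sumSubsets-*ˡ m c (f ∘ (inside ∷_))))
  (sym (*-distribˡ-+ c _ _))

sumSubsets-++ : ∀ m n (h : Subset (m + n) → ℕ) →
                sumSubsets (m + n) h ≡ sumSubsets m λ S → sumSubsets n λ T → h (S ++ T)
sumSubsets-++ zero    n h = refl
sumSubsets-++ (suc m) n h =
  cong₂ _+_ (sumSubsets-++ m n (h ∘ (outside ∷_))) (sumSubsets-++ m n (h ∘ (inside ∷_)))

sumSubsets-* : ∀ m n (f : Subset m → ℕ) (g : Subset n → ℕ) →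
               (sumSubsets m λ S → sumSubsets n λ T → f S * g T) ≡ sumSubsets m f * sumSubsets n g
sumSubsets-* zero    n f g = sumSubsets-*ˡ n (f []) g
sumSubsets-* (suc m) n f g = trans
  (cong₂ _+_ (sumSubsets-* m n (f ∘ (outside ∷_)) g) (sumSubsets-* m n (f ∘ (inside ∷_)) g))
  (sym (*-distribʳ-+ (sumSubsets n g) (sumSubsets m (f ∘ (outside ∷_))) _))

length-filter-map : {P : B → Set} (P? : Decidable P) (f : A → B) (xs : List A) →
                    length (filter P? (List.map f xs)) ≡ length (filter (P? ∘ f) xs)
length-filter-map P? f []       = refl
length-filter-map P? f (x ∷ xs) with does (P? (f x))
... | true  = cong suc (length-filter-map P? f xs)
... | false = length-filter-map P? f xs

-- Passes from the list count in `N-CSSG` to sums, which factor along `++` and distribute over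
-- disjoint cases.
length-filter-allSubsets : ∀ m {P : Subset m → Set} (P? : Decidable P) →
                           length (filter P? (allSubsets m)) ≡ sumSubsets m (indicator ∘ P?)
length-filter-allSubsets zero P? with does (P? [])
... | true  = refl
... | false = refl
length-filter-allSubsets (suc m) P? = begin
  length (filter P? (outs List.++ ins))
    ≡⟨ cong length (filter-++ P? outs ins) ⟩
  length (filter P? outs List.++ filter P? ins)
    ≡⟨ length-++ (filter P? outs) ⟩
  length (filter P? outs) + length (filter P? ins)
    ≡⟨ cong₂ _+_ (half outside) (half inside) ⟩
  sumSubsets (suc m) (indicator ∘ P?)
    ∎
  where
  outs = List.map (outside ∷_) (allSubsets m)
  ins  = List.map (inside ∷_) (allSubsets m)
  half : ∀ s → length (filter P? (List.map (s ∷_) (allSubsets m)))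
               ≡ sumSubsets m (indicator ∘ P? ∘ (s ∷_))
  half s = trans (length-filter-map P? (s ∷_) (allSubsets m))
                 (length-filter-allSubsets m (P? ∘ (s ∷_)))

-- Connected and split edge sets

Edges : ℕ → ℕ → Set
Edges v m = Vec (Fin v × Fin v) m

-- Taken over a bare edge vector so that a wedge without its extra edge can be counted without
-- building a `Graph`. On `Graph.edges G` it is `ConnectedSpanning G` by definition.
Connected : Edges v m → Subset m → Set
Connected es S = ∀ a b → Walk es S a b

record Split (x y : Fin v) (es : Edges v m) (S : Subset m) : Set where
  constructor split
  field
    separated : ¬ Walk es S x y
    covered   : ∀ a → Walk es S x a ⊎ Walk es S y a

open Split

connected? : (es : Edges v m) → Decidable (Connected es)
connected? es S = all? λ a → all? λ b → walk? es S a b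

split? : (x y : Fin v) (es : Edges v m) → Decidable (Split x y es)
split? x y es S = map′ (λ (p , q) → split p q) (λ (split p q) → p , q)
  (¬? (walk? es S x y) ×-dec all? λ a → walk? es S x a ⊎-dec walk? es S y a)

#connected : Edges v m → ℕ
#connected es = sumSubsets _ (indicator ∘ connected? es)

#split : Fin v → Fin v → Edges v m → ℕ
#split x y es = sumSubsets _ (indicator ∘ split? x y es)

module _ (es : Edges v m) (S : Subset m) where

  symmetric : ∀ {a b} → Walk es S a b → Walk es S b a
  symmetric = Eq.symmetric (Joins es S)

  connected-from : ∀ x → (∀ a → Walk es S x a) → Connected es S
  connected-from x reach a b = symmetric (reach a) ◅◅ reach b

  connected⇒¬split : ∀ {x y} → Connected es S → ¬ Split x y es S
  connected⇒¬split conn sp = separated sp (conn _ _)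

module _ (x y : Fin v) (es : Edges v m) (S : Subset m) where

  private
    xy∷es = (x , y) ∷ es

  weaken : ∀ s {a b} → Walk es S a b → Walk xy∷es (s ∷ S) a b
  weaken s = Eq.map {R = Joins es S} λ (e , e∈S , eq) → suc e , there e∈S , eq

  skip : ∀ {a b} → Walk xy∷es (outside ∷ S) a b → Walk es S a b
  skip = Eq.map {R = Joins xy∷es (outside ∷ S)} λ { (suc e , there e∈S , eq) → e , e∈S , eq }

  new-edge : Walk xy∷es (inside ∷ S) x y
  new-edge = fwd (zero , here , refl) ◅ ε

  -- Follows the walk edge by edge. An old edge extends the walk kept so far; crossing the new edge
  -- lands on `x` or `y` itself, so that walk is discarded and restarted as the empty one.
  reached : ∀ {a b} → Walk xy∷es (inside ∷ S) a b →
            Walk es S x a ⊎ Walk es S y a → Walk es S x b ⊎ Walk es S y b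
  reached ε       p = p
  reached (j ◅ w) p = reached w (step j p)
    where
    step : ∀ {a b} → SymClosure (Joins xy∷es (inside ∷ S)) a b →
           Walk es S x a ⊎ Walk es S y a → Walk es S x b ⊎ Walk es S y b
    step (fwd (zero , here , refl))      _ = inj₂ ε
    step (bwd (zero , here , refl))      _ = inj₁ ε
    step (fwd (suc e , there e∈S , eq)) p =
      Sum.map (_◅◅ (fwd (e , e∈S , eq) ◅ ε)) (_◅◅ (fwd (e , e∈S , eq) ◅ ε)) p
    step (bwd (suc e , there e∈S , eq)) p =
      Sum.map (_◅◅ (bwd (e , e∈S , eq) ◅ ε)) (_◅◅ (bwd (e , e∈S , eq) ◅ ε)) p

  connected-outside : Connected xy∷es (outside ∷ S) ⇔ Connected es S
  connected-outside = mk⇔ (λ conn a b → skip (conn a b)) (λ conn a b → weaken outside (conn a b))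

  split-outside : Split x y xy∷es (outside ∷ S) ⇔ Split x y es S
  split-outside = mk⇔
    (λ (split sep cov) → split (sep ∘ weaken outside) (Sum.map skip skip ∘ cov))
    (λ (split sep cov) → split (sep ∘ skip) (Sum.map (weaken outside) (weaken outside) ∘ cov))

  -- The edge `xy` merges only the components of `x` and `y`. By `reached`, these two already cover
  -- all vertices without it, and whether they coincide decides between the alternatives.
  connected-inside : Connected xy∷es (inside ∷ S) ⇔ (Connected es S ⊎ Split x y es S)
  connected-inside = mk⇔ to from
    where
    to : Connected xy∷es (inside ∷ S) → Connected es S ⊎ Split x y es S
    to conn with walk? es S x y
    ... | no ¬x~y = inj₂ (split ¬x~y λ a → reached (conn x a) (inj₁ ε))
    ... | yes x~y = inj₁ (connected-from es S x λ a →
                      Sum.[ (λ p → p) , (x~y ◅◅_) ]′ (reached (conn x a) (inj₁ ε)))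
    from : Connected es S ⊎ Split x y es S → Connected xy∷es (inside ∷ S)
    from (inj₁ conn)          a b = weaken inside (conn a b)
    from (inj₂ (split _ cov))     = connected-from xy∷es (inside ∷ S) x λ a →
      Sum.[ weaken inside , (λ p → new-edge ◅◅ weaken inside p) ]′ (cov a)

  ¬split-inside : ¬ Split x y xy∷es (inside ∷ S)
  ¬split-inside sp = separated sp new-edge

-- Sets without the edge `xy` give the first term. Sets with it give the bracket, as connected and
-- split exclude each other.
#connected-∷ : ∀ x y (es : Edges v m) →
               #connected ((x , y) ∷ es) ≡ #connected es + (#connected es + #split x y es)
#connected-∷ x y es = cong₂ _+_
  (sumSubsets-cong _ λ S → indicator-⇔ (connected-outside x y es S)
                                         (connected? ((x , y) ∷ es) (outside ∷ S)) (connected? es S))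
  (trans (sumSubsets-cong _ λ S → trans
           (indicator-⇔ (connected-inside x y es S) (connected? ((x , y) ∷ es) (inside ∷ S))
                        (connected? es S ⊎-dec split? x y es S))
           (indicator-⊎ (λ (p , q) → connected⇒¬split es S p q) (connected? es S) (split? x y es S)))
         (sumSubsets-+ _ (indicator ∘ connected? es) (indicator ∘ split? x y es)))

-- A set containing the edge `xy` does not separate `x` from `y`, so only the `outside` half
-- contributes.
#split-∷ : ∀ x y (es : Edges v m) → #split x y ((x , y) ∷ es) ≡ #split x y es
#split-∷ {m = m} x y es = trans
  (cong₂ _+_
    (sumSubsets-cong _ λ S → indicator-⇔ (split-outside x y es S)
                                           (split? x y _ (outside ∷ S)) (split? x y es S))
    (trans (sumSubsets-cong _ λ S → indicator-no (¬split-inside x y es S) (split? x y _ (inside ∷ S)))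
           (sumSubsets-0 m)))
  (+-identityʳ _)

-- Wedges

joins-++⁻ : (es : Edges v m) (S : Subset m) {fs : Edges v n} {T : Subset n} → ∀ {a b} →
            Joins (es ++ fs) (S ++ T) a b → Joins es S a b ⊎ Joins fs T a b
joins-++⁻ []       []      j                        = inj₂ j
joins-++⁻ (_ ∷ es) (_ ∷ S) (zero , here , eq)       = inj₁ (zero , here , eq)
joins-++⁻ (_ ∷ es) (_ ∷ S) (suc e , there e∈S , eq) =
  Sum.map₁ (λ (e , e∈S , eq) → suc e , there e∈S , eq) (joins-++⁻ es S (e , e∈S , eq))

joins-++⁺ˡ : (es : Edges v m) (S : Subset m) {fs : Edges v n} {T : Subset n} → ∀ {a b} →
             Joins es S a b → Joins (es ++ fs) (S ++ T) a b
joins-++⁺ˡ (_ ∷ _)  (_ ∷ _) (zero , here , eq)       = zero , here , eq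
joins-++⁺ˡ (_ ∷ es) (_ ∷ S) (suc e , there e∈S , eq) =
  let e , e∈S , eq = joins-++⁺ˡ es S (e , e∈S , eq) in suc e , there e∈S , eq

joins-++⁺ʳ : (es : Edges v m) (S : Subset m) {fs : Edges v n} {T : Subset n} → ∀ {a b} →
             Joins fs T a b → Joins (es ++ fs) (S ++ T) a b
joins-++⁺ʳ []       []      j = j
joins-++⁺ʳ (_ ∷ es) (_ ∷ S) j =
  let e , e∈S , eq = joins-++⁺ʳ es S j in suc e , there e∈S , eq

joins-map⁺ : (f : Fin k → Fin l) {es : Edges k m} {S : Subset m} → ∀ {a b} →
             Joins es S a b → Joins (map (both f) es) S (f a) (f b)
joins-map⁺ f {es} (e , e∈S , eq) = e , e∈S , trans (lookup-map e (both f) es) (cong (both f) eq)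

joins-map⁻ : (f : Fin k → Fin l) (es : Edges k m) {S : Subset m} → ∀ {a b} →
             Joins (map (both f) es) S a b →
             ∃₂ λ a′ b′ → Joins es S a′ b′ × f a′ ≡ a × f b′ ≡ b
joins-map⁻ f es (e , e∈S , eq) =
  _ , _ , (e , e∈S , refl) , ,-injective (trans (sym (lookup-map e (both f) es)) eq)

-- The retractions of the wedge onto its two parts: each collapses the other
-- part to the common vertex.

toLeft : ∀ k l → Fin (suc (k + l)) → Fin (suc k)
toLeft zero    l _       = zero
toLeft (suc k) l zero    = zero
toLeft (suc k) l (suc i) = suc (toLeft k l i)

toRight : ∀ k l → Fin (suc (k + l)) → Fin (suc l)
toRight zero    l i       = i
toRight (suc k) l zero    = zero
toRight (suc k) l (suc i) = toRight k l i

toLeft-fromLeft : ∀ k l i → toLeft k l (fromLeft k l i) ≡ i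
toLeft-fromLeft zero    l zero    = refl
toLeft-fromLeft (suc k) l zero    = refl
toLeft-fromLeft (suc k) l (suc i) = cong suc (toLeft-fromLeft k l i)

toLeft-fromRight : ∀ k l j → toLeft k l (fromRight k l j) ≡ fromℕ k
toLeft-fromRight zero    l j = refl
toLeft-fromRight (suc k) l j = cong suc (toLeft-fromRight k l j)

toRight-fromLeft : ∀ k l i → toRight k l (fromLeft k l i) ≡ zero
toRight-fromLeft zero    l zero    = refl
toRight-fromLeft (suc k) l zero    = refl
toRight-fromLeft (suc k) l (suc i) = toRight-fromLeft k l i

toRight-fromRight : ∀ k l j → toRight k l (fromRight k l j) ≡ j
toRight-fromRight zero    l j = refl
toRight-fromRight (suc k) l j = toRight-fromRight k l j

fromRight-fromℕ : ∀ k l → fromRight k l (fromℕ l) ≡ fromℕ (k + l)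
fromRight-fromℕ zero    l = refl
fromRight-fromℕ (suc k) l = cong suc (fromRight-fromℕ k l)

-- The constructors overlap at the common vertex, which `side` classifies as `right`.
data Side (k l : ℕ) : Fin (suc (k + l)) → Set where
  left  : ∀ i → Side k l (fromLeft k l i)
  right : ∀ j → Side k l (fromRight k l j)

side : ∀ k l a → Side k l a
side zero    l a    = right a
side (suc k) l zero = left zero
side (suc k) l (suc a) with side k l a
... | left i  = left (suc i)
... | right j = right j

-- Definitionally the tail of the edge vector of `glue`, whose head is the new edge XY.
wedge : Edges (suc k) m → Edges (suc l) n → Edges (suc (k + l)) (m + n)
wedge {k = k} {l = l} es fs = map (both (fromLeft k l)) es ++ map (both (fromRight k l)) fs

module _ {k l m n : ℕ} (es : Edges (suc k) m) (S : Subset m)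
         (fs : Edges (suc l) n) (T : Subset n) where

  private
    WalkWedge = Walk (wedge es fs) (S ++ T)
    WalkL     = Walk es S
    WalkR     = Walk fs T
    X₁ Y₁ : Fin (suc k)
    X₁ = zero
    Y₁ = fromℕ k
    X₂ Y₂ : Fin (suc l)
    X₂ = zero
    Y₂ = fromℕ l
    X Y : Fin (suc (k + l))
    X = zero
    Y = fromℕ (k + l)
    Y′ = fromRight k l Y₂
    symW = symmetric (wedge es fs) (S ++ T)
    symL = symmetric es S
    symR = symmetric fs T
    rL   = toLeft k l
    rR   = toRight k l

  walk-fromLeft : ∀ {a b} → WalkL a b → WalkWedge (fromLeft k l a) (fromLeft k l b)
  walk-fromLeft = Eq.gmap {R = Joins es S} (fromLeft k l)
    (joins-++⁺ˡ (map (both (fromLeft k l)) es) S ∘ joins-map⁺ (fromLeft k l) {es})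

  walk-fromRight : ∀ {a b} → WalkR a b → WalkWedge (fromRight k l a) (fromRight k l b)
  walk-fromRight = Eq.gmap {R = Joins fs T} (fromRight k l)
    (joins-++⁺ʳ (map (both (fromLeft k l)) es) S ∘ joins-map⁺ (fromRight k l) {fs})

  walk-across : ∀ {i j} → WalkL i Y₁ → WalkR X₂ j → WalkWedge (fromLeft k l i) (fromRight k l j)
  walk-across p q =
    walk-fromLeft p ◅◅ subst (λ c → WalkWedge c (fromRight k l _)) (sym (identified k l)) (walk-fromRight q)

  -- The retraction sends a left edge back to itself and both ends of a right edge to `Y₁`, where
  -- the empty walk suffices.
  walk-toLeft : ∀ {a b} → WalkWedge a b → WalkL (toLeft k l a) (toLeft k l b)
  walk-toLeft = Eq.gfold {R = Joins (wedge es fs) (S ++ T)} (Eq.isEquivalence (Joins es S))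
                         (toLeft k l) step
    where
    step : ∀ {a b} → Joins (wedge es fs) (S ++ T) a b → WalkL (toLeft k l a) (toLeft k l b)
    step j with joins-++⁻ (map (both (fromLeft k l)) es) S j
    step j | inj₁ j₁ with a , b , j′ , refl , refl ← joins-map⁻ (fromLeft k l) es j₁
      rewrite toLeft-fromLeft k l a | toLeft-fromLeft k l b = fwd j′ ◅ ε
    step j | inj₂ j₂ with a , b , _ , refl , refl ← joins-map⁻ (fromRight k l) fs j₂
      rewrite toLeft-fromRight k l a | toLeft-fromRight k l b = ε

  walk-toRight : ∀ {a b} → WalkWedge a b → WalkR (toRight k l a) (toRight k l b)
  walk-toRight = Eq.gfold {R = Joins (wedge es fs) (S ++ T)} (Eq.isEquivalence (Joins fs T))
                          (toRight k l) step
    where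
    step : ∀ {a b} → Joins (wedge es fs) (S ++ T) a b → WalkR (toRight k l a) (toRight k l b)
    step j with joins-++⁻ (map (both (fromLeft k l)) es) S j
    step j | inj₁ j₁ with a , b , _ , refl , refl ← joins-map⁻ (fromLeft k l) es j₁
      rewrite toRight-fromLeft k l a | toRight-fromLeft k l b = ε
    step j | inj₂ j₂ with a , b , j′ , refl , refl ← joins-map⁻ (fromRight k l) fs j₂
      rewrite toRight-fromRight k l a | toRight-fromRight k l b = fwd j′ ◅ ε

  -- Converse to the two projections. For vertices in one part, the walk in that part is enough; for
  -- vertices on opposite sides, each projected walk has one end at the common vertex, and the two
  -- are joined there.
  walk-wedge : ∀ a b → WalkL (toLeft k l a) (toLeft k l b) →
               WalkR (toRight k l a) (toRight k l b) → WalkWedge a b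
  walk-wedge a b p q with side k l a | side k l b
  walk-wedge _ _ p q | left i | left j
    rewrite toLeft-fromLeft k l i | toLeft-fromLeft k l j = walk-fromLeft p
  walk-wedge _ _ p q | left i | right j
    rewrite toLeft-fromLeft k l i | toLeft-fromRight k l j
          | toRight-fromLeft k l i | toRight-fromRight k l j = walk-across p q
  walk-wedge _ _ p q | right i | left j
    rewrite toLeft-fromLeft k l j | toLeft-fromRight k l i
          | toRight-fromLeft k l j | toRight-fromRight k l i =
    symW (walk-across (symL p) (symR q))
  walk-wedge _ _ p q | right i | right j
    rewrite toRight-fromRight k l i | toRight-fromRight k l j = walk-fromRight q

  walk-left⁻ : ∀ {i j} → WalkWedge (fromLeft k l i) (fromLeft k l j) → WalkL i j
  walk-left⁻ {i} {j} w with walk-toLeft w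
  ... | p rewrite toLeft-fromLeft k l i | toLeft-fromLeft k l j = p

  walk-right⁻ : ∀ {i j} → WalkWedge (fromRight k l i) (fromRight k l j) → WalkR i j
  walk-right⁻ {i} {j} w with walk-toRight w
  ... | p rewrite toRight-fromRight k l i | toRight-fromRight k l j = p

  walk-across⁻ : ∀ {i j} → WalkWedge (fromLeft k l i) (fromRight k l j) → WalkL i Y₁ × WalkR X₂ j
  walk-across⁻ {i} {j} w with walk-toLeft w | walk-toRight w
  ... | p | q rewrite toLeft-fromLeft k l i | toLeft-fromRight k l j
                    | toRight-fromLeft k l i | toRight-fromRight k l j = p , q

  -- The retractions of `X` do not reduce while `k` is a variable, hence the transports.
  walk-X : ∀ a → WalkL X₁ (rL a) → WalkR X₂ (rR a) → WalkWedge X a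
  walk-X a p q = walk-wedge X a
    (subst (λ c → WalkL c (rL a)) (sym (toLeft-fromLeft k l X₁)) p)
    (subst (λ c → WalkR c (rR a)) (sym (toRight-fromLeft k l X₁)) q)

  walk-Y : ∀ a → WalkL Y₁ (rL a) → WalkR Y₂ (rR a) → WalkWedge Y′ a
  walk-Y a p q = walk-wedge Y′ a
    (subst (λ c → WalkL c (rL a)) (sym (toLeft-fromRight k l Y₂)) p)
    (subst (λ c → WalkR c (rR a)) (sym (toRight-fromRight k l Y₂)) q)

  connected-wedge : Connected (wedge es fs) (S ++ T) ⇔ (Connected es S × Connected fs T)
  connected-wedge = mk⇔
    (λ conn → (λ a b → walk-left⁻ (conn _ _)) , (λ a b → walk-right⁻ (conn _ _)))
    (λ (c₁ , c₂) a b → walk-wedge a b (c₁ _ _) (c₂ _ _))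

  -- Every walk from X to Y passes through the common vertex, so at least one part separates its
  -- special vertices. If both did, the common vertex would be reached from neither X nor Y; hence
  -- exactly one does, and the cover condition makes the other part connected.
  split-wedge : Split X Y (wedge es fs) (S ++ T) ⇔
                (Connected es S × Split X₂ Y₂ fs T ⊎ Split X₁ Y₁ es S × Connected fs T)
  -- The proof works with `Y′`, written as an image under `fromRight` so that the walk lemmas for
  -- the right part apply.
  split-wedge = subst
    (λ y → Split X y (wedge es fs) (S ++ T) ⇔
           (Connected es S × Split X₂ Y₂ fs T ⊎ Split X₁ Y₁ es S × Connected fs T))
    (fromRight-fromℕ k l) (mk⇔ to from)
    where
    to : Split X Y′ (wedge es fs) (S ++ T) →
         Connected es S × Split X₂ Y₂ fs T ⊎ Split X₁ Y₁ es S × Connected fs T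
    to (split sep cov) with walk? es S X₁ Y₁
    ... | yes p = inj₁ (connected-from es S X₁ reach₁ , split sep₂ cov₂)
      where
      sep₂ : ¬ WalkR X₂ Y₂
      sep₂ q = sep (walk-across p q)
      reach₁ : ∀ i → WalkL X₁ i
      reach₁ i with cov (fromLeft k l i)
      ... | inj₁ w = walk-left⁻ w
      -- A walk from Y back into the left part would cross the common vertex and so join `X₂` to
      -- `Y₂`.
      ... | inj₂ w = contradiction (proj₂ (walk-across⁻ (symW w))) sep₂
      cov₂ : ∀ j → WalkR X₂ j ⊎ WalkR Y₂ j
      cov₂ j = Sum.map (proj₂ ∘ walk-across⁻) walk-right⁻ (cov (fromRight k l j))
    ... | no ¬p = inj₂ (split ¬p cov₁ , connected-from fs T Y₂ reach₂)
      where
      cov₁ : ∀ i → WalkL X₁ i ⊎ WalkL Y₁ i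
      cov₁ i = Sum.map walk-left⁻ (λ w → symL (proj₁ (walk-across⁻ (symW w))))
                       (cov (fromLeft k l i))
      reach₂ : ∀ j → WalkR Y₂ j
      reach₂ j with cov (fromRight k l j)
      ... | inj₁ w = contradiction (proj₁ (walk-across⁻ w)) ¬p
      ... | inj₂ w = walk-right⁻ w

    from : Connected es S × Split X₂ Y₂ fs T ⊎ Split X₁ Y₁ es S × Connected fs T →
           Split X Y′ (wedge es fs) (S ++ T)
    -- With the left part connected, the component of a vertex depends only on its right retraction.
    from (inj₁ (c₁ , split sep₂ cov₂)) = split (sep₂ ∘ proj₂ ∘ walk-across⁻) λ a →
      Sum.map (walk-X a (c₁ X₁ (rL a))) (walk-Y a (c₁ Y₁ (rL a))) (cov₂ (rR a))
    from (inj₂ (split sep₁ cov₁ , c₂)) = split (sep₁ ∘ proj₁ ∘ walk-across⁻) λ a →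
      Sum.map (λ p → walk-X a p (c₂ X₂ (rR a))) (λ p → walk-Y a p (c₂ Y₂ (rR a))) (cov₁ (rL a))

#connected-wedge : (es : Edges (suc k) m) (fs : Edges (suc l) n) →
                   #connected (wedge es fs) ≡ #connected es * #connected fs
#connected-wedge {m = m} {n = n} es fs = begin
  #connected (wedge es fs)
    ≡⟨ sumSubsets-++ m n (indicator ∘ connected? (wedge es fs)) ⟩
  (sumSubsets m λ S → sumSubsets n λ T → indicator (connected? (wedge es fs) (S ++ T)))
    ≡⟨ (sumSubsets-cong m λ S → sumSubsets-cong n λ T → trans
         (indicator-⇔ (connected-wedge es S fs T) (connected? (wedge es fs) (S ++ T))
                      (connected? es S ×-dec connected? fs T))
         (indicator-× (connected? es S) (connected? fs T))) ⟩
  (sumSubsets m λ S → sumSubsets n λ T → indicator (connected? es S) * indicator (connected? fs T))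
    ≡⟨ sumSubsets-* m n _ _ ⟩
  #connected es * #connected fs
    ∎

#split-wedge : (es : Edges (suc k) m) (fs : Edges (suc l) n) →
               #split zero (fromℕ (k + l)) (wedge es fs) ≡
               #connected es * #split zero (fromℕ l) fs + #split zero (fromℕ k) es * #connected fs
#split-wedge {k = k} {m = m} {l = l} {n = n} es fs = begin
  #split zero (fromℕ (k + l)) (wedge es fs)
    ≡⟨ sumSubsets-++ m n (indicator ∘ splitW?) ⟩
  (sumSubsets m λ S → sumSubsets n λ T → indicator (splitW? (S ++ T)))
    ≡⟨ (sumSubsets-cong m λ S → sumSubsets-cong n λ T → pointwise S T) ⟩
  (sumSubsets m λ S → sumSubsets n λ T → c₁ S * s₂ T + s₁ S * c₂ T)
    ≡⟨ (sumSubsets-cong m λ S → sumSubsets-+ n (λ T → c₁ S * s₂ T) (λ T → s₁ S * c₂ T)) ⟩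
  (sumSubsets m λ S → (sumSubsets n λ T → c₁ S * s₂ T) + (sumSubsets n λ T → s₁ S * c₂ T))
    ≡⟨ sumSubsets-+ m _ _ ⟩
  (sumSubsets m λ S → sumSubsets n λ T → c₁ S * s₂ T)
    + (sumSubsets m λ S → sumSubsets n λ T → s₁ S * c₂ T)
    ≡⟨ cong₂ _+_ (sumSubsets-* m n c₁ s₂) (sumSubsets-* m n s₁ c₂) ⟩
  #connected es * #split zero (fromℕ l) fs + #split zero (fromℕ k) es * #connected fs
    ∎
  where
  splitW? = split? zero (fromℕ (k + l)) (wedge es fs)
  conn₁?  = connected? es
  conn₂?  = connected? fs
  split₁? = split? zero (fromℕ k) es
  split₂? = split? zero (fromℕ l) fs
  c₁ = indicator ∘ conn₁?
  c₂ = indicator ∘ conn₂?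
  s₁ = indicator ∘ split₁?
  s₂ = indicator ∘ split₂?
  pointwise : ∀ S T → indicator (splitW? (S ++ T)) ≡ c₁ S * s₂ T + s₁ S * c₂ T
  pointwise S T = begin
    indicator (splitW? (S ++ T))
      ≡⟨ indicator-⇔ (split-wedge es S fs T) (splitW? (S ++ T))
           (conn₁? S ×-dec split₂? T ⊎-dec split₁? S ×-dec conn₂? T) ⟩
    indicator (conn₁? S ×-dec split₂? T ⊎-dec split₁? S ×-dec conn₂? T)
      ≡⟨ indicator-⊎ (λ ((c , _) , (s , _)) → connected⇒¬split es S c s)
           (conn₁? S ×-dec split₂? T) (split₁? S ×-dec conn₂? T) ⟩
    indicator (conn₁? S ×-dec split₂? T) + indicator (split₁? S ×-dec conn₂? T)
      ≡⟨ cong₂ _+_ (indicator-× (conn₁? S) (split₂? T)) (indicator-× (split₁? S) (conn₂? T)) ⟩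
    c₁ S * s₂ T + s₁ S * c₂ T
      ∎

-- The Farey recursion

#splitXY : Graph (suc k) → ℕ
#splitXY {k = k} G = #split zero (fromℕ k) (Graph.edges G)

N-CSSG-#connected : (G : Graph v) → N-CSSG G ≡ #connected (Graph.edges G)
N-CSSG-#connected G = length-filter-allSubsets _ (connectedSpanning? G)

module _ (0<k : 0 < k) (0<l : 0 < l) (G : Graph (suc k)) (H : Graph (suc l)) where

  private
    es = Graph.edges G
    fs = Graph.edges H

  #splitXY-glue : #splitXY (glue 0<k 0<l G H) ≡ N-CSSG G * #splitXY H + #splitXY G * N-CSSG H
  #splitXY-glue rewrite N-CSSG-#connected G | N-CSSG-#connected H =
    trans (#split-∷ zero (fromℕ (k + l)) (wedge es fs)) (#split-wedge es fs)

  N-CSSG-glue : N-CSSG (glue 0<k 0<l G H) ≡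
                N-CSSG G * N-CSSG H
                  + (N-CSSG G * N-CSSG H + (N-CSSG G * #splitXY H + #splitXY G * N-CSSG H))
  N-CSSG-glue
    rewrite N-CSSG-#connected (glue 0<k 0<l G H) | N-CSSG-#connected G | N-CSSG-#connected H =
    trans (#connected-∷ zero (fromℕ (k + l)) (wedge es fs))
          (cong₂ (λ c s → c + (c + s)) (#connected-wedge es fs) (#split-wedge es fs))

-- Recursion satisfied by the closed form

-- `applyUpTo` unfolds at its first entry, whereas passing from one Farey product to the next
-- appends a factor at the end.
product-applyUpTo-suc : ∀ f n → product (applyUpTo f (suc n)) ≡ product (applyUpTo f n) * f n
product-applyUpTo-suc f n = begin
  product (applyUpTo f (suc n))                 ≡⟨ cong product (applyUpTo-∷ʳ f n) ⟨
  product (applyUpTo f n List.++ f n ∷ [])      ≡⟨ product-++ (applyUpTo f n) (f n ∷ []) ⟩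
  product (applyUpTo f n) * (f n * 1)           ≡⟨ cong (product (applyUpTo f n) *_) (*-identityʳ (f n)) ⟩
  product (applyUpTo f n) * f n                 ∎

-- The pointwise equation is required only below `n`: with truncated subtraction, `n ∸ j` is the
-- successor of `n ∸ suc j` only there.
product-applyUpTo-square : ∀ (f g : ℕ → ℕ) n → (∀ {j} → j < n → f j ≡ g j * g j) →
                           product (applyUpTo f n) ≡ product (applyUpTo g n) * product (applyUpTo g n)
product-applyUpTo-square f g zero    eq = refl
product-applyUpTo-square f g (suc n) eq = begin
  product (applyUpTo f (suc n))
    ≡⟨ product-applyUpTo-suc f n ⟩
  product (applyUpTo f n) * f n
    ≡⟨ cong₂ _*_ (product-applyUpTo-square f g n (λ j<n → eq (m≤n⇒m≤1+n j<n))) (eq ≤-refl) ⟩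
  (Πg * Πg) * (g n * g n)
    ≡⟨ regroup Πg (g n) ⟩
  (Πg * g n) * (Πg * g n)
    ≡⟨ cong (λ p → p * p) (product-applyUpTo-suc g n) ⟨
  product (applyUpTo g (suc n)) * product (applyUpTo g (suc n))
    ∎
  where
  Πg = product (applyUpTo g n)
  regroup : ∀ p x → (p * p) * (x * x) ≡ (p * x) * (p * x)
  regroup = solve-∀

^-double : ∀ b e → b ^ (2 * e) ≡ b ^ e * b ^ e
^-double b e = trans (cong (λ d → b ^ (e + d)) (+-identityʳ e)) (^-distribˡ-+-* b e e)

fareyProduct : ℕ → ℕ
fareyProduct n = ∏[ 2 ⋯ n ] (λ i → i ^ (2 ^ (n ∸ i)))

-- Raising `n` by one doubles every exponent `2 ^ (n ∸ i)`, which squares the old factors, and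
-- appends the factor `suc n` with exponent `2 ^ 0`.
fareyProduct-suc : ∀ n → fareyProduct (suc n) ≡ fareyProduct n * fareyProduct n * suc n
-- Both products are empty here and the appended factor is 1.
fareyProduct-suc zero    = refl
fareyProduct-suc (suc n) = trans (product-applyUpTo-suc f n)
  (cong₂ _*_ (product-applyUpTo-square f g n square) last)
  where
  -- With `i = 2 + j`, `f` lists the factors of `fareyProduct (2 + n)` and `g` those of
  -- `fareyProduct (1 + n)`.
  f g : ℕ → ℕ
  f j = (2 + j) ^ (2 ^ (n ∸ j))
  g j = (2 + j) ^ (2 ^ (n ∸ suc j))
  square : ∀ {j} → j < n → f j ≡ g j * g j
  square {j} j<n = trans
    (cong (λ d → (2 + j) ^ (2 ^ d)) (+-∸-assoc 1 j<n))
    (^-double (2 + j) (2 ^ (n ∸ suc j)))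
  last : f n ≡ 2 + n
  last = trans (cong (λ d → (2 + n) ^ (2 ^ d)) (n∸n≡0 n)) (*-identityʳ (2 + n))

2^[2^n∸1]-suc : ∀ n → 2 ^ (2 ^ suc n ∸ 1) ≡ 2 * (2 ^ (2 ^ n ∸ 1) * 2 ^ (2 ^ n ∸ 1))
-- Nonzeroness forces `2 ^ n` to be some `suc p`, so the truncated differences become `p` and
-- `2 * p + 1`.
2^[2^n∸1]-suc n with 2 ^ n | m^n≢0 2 n
... | suc p | _ = begin
  2 ^ (p + suc (p + 0))    ≡⟨ cong (2 ^_) (+-suc p (p + 0)) ⟩
  2 * 2 ^ (2 * p)          ≡⟨ cong (2 *_) (^-double 2 p) ⟩
  2 * (2 ^ p * 2 ^ p)      ∎

-- The closed form for the number of split sets: the claimed count of connected sets without its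
-- factor `n + 1`.
fareySplit : ℕ → ℕ
fareySplit n = 2 ^ (2 ^ n ∸ 1) * fareyProduct n

fareySplit-suc : ∀ n → fareySplit (suc n) ≡ 2 * (suc n * (fareySplit n * fareySplit n))
fareySplit-suc n = trans (cong₂ _*_ (2^[2^n∸1]-suc n) (fareyProduct-suc n))
                         (regroup (2 ^ (2 ^ n ∸ 1)) (fareyProduct n) (suc n))
  where
  regroup : ∀ a p m → 2 * (a * a) * (p * p * m) ≡ 2 * (m * ((a * p) * (a * p)))
  regroup = solve-∀

-- The two counts are proved together because each recursion involves both.
farey-counts : ∀ n → N-CSSG (farey n) ≡ suc n * fareySplit n × #splitXY (farey n) ≡ fareySplit n
-- For a single edge only the full set is connected and only the empty set is split.
farey-counts zero    = refl , refl
farey-counts (suc n) = t-suc , s-suc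
  where
  G = farey n
  Q = fareySplit n
  t-suc : N-CSSG (farey (suc n)) ≡ suc (suc n) * fareySplit (suc n)
  t-suc = begin
    N-CSSG (farey (suc n))
      ≡⟨ N-CSSG-glue (span>0 n) (span>0 n) G G ⟩
    N-CSSG G * N-CSSG G + (N-CSSG G * N-CSSG G + (N-CSSG G * #splitXY G + #splitXY G * N-CSSG G))
      ≡⟨ cong₂ (λ t s → t * t + (t * t + (t * s + s * t)))
               (proj₁ (farey-counts n)) (proj₂ (farey-counts n)) ⟩
    (suc n * Q) * (suc n * Q)
      + ((suc n * Q) * (suc n * Q) + ((suc n * Q) * Q + Q * (suc n * Q)))
      -- With t = (n + 1)Q and s = Q, the sum 2t² + 2ts is 2(n + 1)Q² times (n + 1) + 1.
      ≡⟨ regroup n Q ⟩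
    suc (suc n) * (2 * (suc n * (Q * Q)))
      ≡⟨ cong (suc (suc n) *_) (fareySplit-suc n) ⟨
    suc (suc n) * fareySplit (suc n)
      ∎
    where
    regroup : ∀ n q → (suc n * q) * (suc n * q)
                        + ((suc n * q) * (suc n * q) + ((suc n * q) * q + q * (suc n * q)))
                      ≡ suc (suc n) * (2 * (suc n * (q * q)))
    regroup = solve-∀
  s-suc : #splitXY (farey (suc n)) ≡ fareySplit (suc n)
  s-suc = begin
    #splitXY (farey (suc n))
      ≡⟨ #splitXY-glue (span>0 n) (span>0 n) G G ⟩
    N-CSSG G * #splitXY G + #splitXY G * N-CSSG G
      ≡⟨ cong₂ (λ t s → t * s + s * t) (proj₁ (farey-counts n)) (proj₂ (farey-counts n)) ⟩
    (suc n * Q) * Q + Q * (suc n * Q)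
      ≡⟨ regroup n Q ⟩
    2 * (suc n * (Q * Q))
      ≡⟨ fareySplit-suc n ⟨
    fareySplit (suc n)
      ∎
    where
    regroup : ∀ n q → (suc n * q) * q + q * (suc n * q) ≡ 2 * (suc n * (q * q))
    regroup = solve-∀

mainTheorem4 : ∀ (n : ℕ) →
    N-CSSG (farey n) ≡
    2 ^ (2 ^ n ∸ 1) * (n + 1) * ∏[ 2 ⋯ n ] (λ i → i ^ (2 ^ (n ∸ i)))
mainTheorem4 n = trans (proj₁ (farey-counts n)) (regroup n (2 ^ (2 ^ n ∸ 1)) (fareyProduct n))
  where
  regroup : ∀ n a p → suc n * (a * p) ≡ a * (n + 1) * p
  regroup = solve-∀
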